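{- Let $\kappa$ be an infinite cardinal, and let $\mathcal{L}\subseteq\mathrm{Scat}_\kappa$ be nonempty and downward $\preceq$-closed and such that $\trianglelefteq^{\mathcal{L}}_\kappa$ is transitive. Then $\trianglelefteq^{\mathcal{L}}_\kappa$ has chains isomorphic to any $L\in\mathrm{Lin}_\kappa$ (including increasing and decreasing chains of order type any $\alpha<\kappa^+$) and, if $\kappa^{<\kappa}=\kappa$, chains of order type $\mathbb{R}_\kappa$; moreover, it has antichains of size $2^\kappa$.
   Context: Linear orders are reflexive and nonempty; $L\preceq L'$ means there is an embedding $f:L\to L'$, i.e. $x\le_L y\iff f(x)\le_{L'}f(y)$. For a cardinal $\kappa$, $\mathrm{LO}_\kappa$ is the set of (codes for) linear orders with domain $\kappa$, $\mathrm{Lin}_\kappa=\bigcup_{0<\lambda\le\kappa}\mathrm{LO}_\lambda$ ($\lambda$ ranging over cardinals), i.e. the nonempty linear orders of size at most $\kappa$, and $\mathrm{Scat}_\kappa\subseteq\mathrm{Lin}_\kappa$ consists of the scattered ones (those $L$ with $\mathbb{Q}\not\preceq L$). $\mathcal{L}\subseteq\mathrm{Lin}_\kappa$ is downward $\preceq$-closed if $K\in\mathrm{Lin}_\kappa$, $K\preceq L\in\mathcal{L}$ imply $K\in\mathcal{L}$; membership is meant up to isomorphism. A subset $I$ of $L$ is convex if $x\le_L y\le_L z$ and $x,z\in I$ imply $y\in I$. A $K$-convex partition of $L$ is a partition $(L_k)_{k\in K}$ of $L$ (into nonempty sets) such that $k<_K k'\iff$ every element of $L_k$ is $<_L$ every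 element of $L_{k'}$. $L\trianglelefteq^{\mathcal{L}}L'$ iff there are $K\in\mathcal{L}$, a $K$-convex partition $(L_k)_{k\in K}$ of $L$, and an embedding $f$ of $L$ into $L'$ such that each $f(L_k)$ is a convex subset of $L'$. $\trianglelefteq^{\mathcal{L}}_\kappa$ is the restriction of $\trianglelefteq^{\mathcal{L}}$ to $\mathrm{LO}_\kappa$. A chain isomorphic to (of order type) a linear order $M$ is a family $(L_x)_{x\in M}$ in $\mathrm{LO}_\kappa$ with $L_x\trianglelefteq^{\mathcal{L}}_\kappa L_y\iff x\le_M y$; an antichain is a set of pairwise $\trianglelefteq^{\mathcal{L}}_\kappa$-incomparable elements. $\mathbb{L}_\kappa=({}^\kappa\kappa,\le_{\mathrm{lex}})$ is the set of functions from $\kappa$ to $\kappa$ ordered lexicographically, and $\mathbb{R}_\kappa=\mathbb{L}_\kappa^*+(\mathbb{L}_\kappa\setminus\{\min\mathbb{L}_\kappa\})$, where $*$ denotes the reverse order. -}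

module Defs where

open import Data.Nat.Base using (ℕ)
open import Data.Product.Base using (Σ; Σ-syntax; ∃; ∃-syntax; _×_)
open import Data.Rational.Base using (ℚ)
open import Data.Rational.Properties using (≤-isTotalOrder)
open import Data.Refinement.Base using (Refinement-syntax; value)
open import Data.Sum.Base using (_⊎_)
open import Data.Sum.Relation.Binary.LeftOrder using (_⊎-<_)
open import Function.Base using (_on_; flip)
open import Function.Bundles using (_⇔_; _↣_; _⤖_; Injection)
open import Induction.WellFounded using (WellFounded)
open import Level using (Level; _⊔_; suc)
open import Relation.Binary.Core using (Rel)
open import Relation.Binary.PropositionalEquality.Core using (_≡_; _≢_)
open import Relation.Binary.Structures using (IsTotalOrder; IsStrictTotalOrder)
import Relation.Binary.Construct.NonStrictToStrict as ToStrict
open import Relation.Nullary.Negation.Core using (¬_)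
open import Relation.Unary using (Pred; _∈_; Satisfiable)

private
  variable
    a b p q r : Level
    A : Set a
    B : Set b

-- The development is meant to be read classically, under excluded middle for
-- all types (not only propositions) and function extensionality.  Since ∃ is
-- a Σ-type, this makes the axiom of choice available as well.

record LO (A : Set a) : Set (suc a) where
  field
    _≤_          : Rel A a
    isTotalOrder : IsTotalOrder _≡_ _≤_

  open ToStrict _≡_ _≤_ public using (_<_)

IsEmbedding : LO A → LO B → (A → B) → Set _
IsEmbedding L M f = ∀ x y → (x L.≤ y) ⇔ (f x M.≤ f y)
  where
  module L = LO L
  module M = LO M

infix 4 _≼_

_≼_ : LO A → LO B → Set _
L ≼ M = ∃[ f ] IsEmbedding L M f

ℚ-order : LO ℚ
ℚ-order = record { isTotalOrder = ≤-isTotalOrder }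

Scattered : LO A → Set _
Scattered L = ¬ (ℚ-order ≼ L)

Convex : LO A → Pred A p → Set _
Convex L I = ∀ {x y z} → x ≤ y → y ≤ z → x ∈ I → z ∈ I → y ∈ I
  where open LO L

image : (A → B) → Pred A p → Pred B _
image f P y = ∃[ x ] x ∈ P × f x ≡ y

record ConvexPartition {A : Set a} {B : Set b}
                       (K : LO B) (L : LO A) : Set (suc a ⊔ b) where
  private
    module K = LO K
    module L = LO L
  field
    part     : B → Pred A a
    nonempty : ∀ k → Satisfiable (part k)
    covers   : ∀ x → ∃[ k ] x ∈ part k
    disjoint : ∀ {k k′ x} → x ∈ part k → x ∈ part k′ → k ≡ k′
    ordered  : ∀ k k′ → (k K.< k′) ⇔
                 (∀ {x y} → x ∈ part k → y ∈ part k′ → x L.< y)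

-- An infinite cardinal is represented as an infinite initial ordinal: a
-- well-ordered type not equipotent to any of its proper initial segments.

record InfiniteCardinal ℓ : Set (suc ℓ) where
  infix 4 _<_
  field
    Carrier            : Set ℓ
    _<_                : Rel Carrier ℓ
    isStrictTotalOrder : IsStrictTotalOrder _≡_ _<_
    wellFounded        : WellFounded _<_
    initial            : ∀ α → ¬ ([ β ∈ Carrier ∣ β < α ] ⤖ Carrier)
    infinite           : ℕ ↣ Carrier

-- Nonempty linear orders of size at most that of A.

record Lin (A : Set a) : Set (suc a) where
  field
    Carrier    : Set a
    order      : LO Carrier
    inhabitant : Carrier
    size       : Carrier ↣ A

  open LO order public

DownwardClosed : {A : Set a} → Pred (Lin A) p → Set _
DownwardClosed 𝓛 = ∀ {K L} → Lin.order K ≼ Lin.order L → L ∈ 𝓛 → K ∈ 𝓛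

-- L ⊴[ 𝓛 ] M is ⊴^𝓛; the index X plays the role of κ.

infix 4 _⊴[_]_

_⊴[_]_ : {X : Set a} {A : Set b} {B : Set q} →
         LO A → Pred (Lin X) p → LO B → Set _
L ⊴[ 𝓛 ] M =
  ∃[ K ] K ∈ 𝓛 ×
  Σ[ P ∈ ConvexPartition (Lin.order K) L ]
  ∃[ f ] IsEmbedding L M f ×
         (∀ k → Convex M (image f (ConvexPartition.part P k)))

module _ {κ : Set a} (𝓛 : Pred (Lin κ) p) where

  -- ⊴^𝓛_κ, the restriction to orders with domain κ.

  ⊴κ : Rel (LO κ) _
  ⊴κ L M = L ⊴[ 𝓛 ] M

  HasChain : {M : Set b} → Rel M r → Set _
  HasChain {M = M} _≤_ =
    Σ[ L ∈ (M → LO κ) ] (∀ x y → ⊴κ (L x) (L y) ⇔ (x ≤ y))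

  Incomparable : Rel (LO κ) _
  Incomparable L M = ¬ ⊴κ L M × ¬ ⊴κ M L

  HasAntichainOfSize : Set b → Set _
  HasAntichainOfSize S =
    Σ[ F ∈ S ↣ LO κ ]
      (∀ s t → s ≢ t → Incomparable (Injection.to F s) (Injection.to F t))

-- Nonempty ordinals below κ⁺ are the well-founded members of Lin κ.

IsWellOrder : {A : Set a} → Lin A → Set _
IsWellOrder L = WellFounded (Lin._<_ L)

module _ {ℓ} (𝜿 : InfiniteCardinal ℓ) where

  open InfiniteCardinal 𝜿 renaming (Carrier to κ)

  -- κ^{<κ} = κ, where κ^{<κ} is the cardinality of ⋃_{α<κ} {}^α κ.

  κ^<κ≡κ : Set _
  κ^<κ≡κ = (Σ[ α ∈ κ ] ([ β ∈ κ ∣ β < α ] → κ)) ⤖ κ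

  infix 4 _<lex_ _≤lex_

  _<lex_ : Rel (κ → κ) _
  f <lex g = ∃[ α ] f α < g α × (∀ β → β < α → f β ≡ g β)

  _≤lex_ : Rel (κ → κ) _
  f ≤lex g = f ≡ g ⊎ f <lex g

  IsMin : Pred (κ → κ) _
  IsMin f = ∀ g → f ≤lex g

  ℝκ : Set _
  ℝκ = (κ → κ) ⊎ [ f ∈ (κ → κ) ∣ ¬ IsMin f ]

  ℝκ-≤ : Rel ℝκ _
  ℝκ-≤ = flip _≤lex_ ⊎-< (_≤lex_ on value)

{-# OPTIONS --safe #-}
module Submission where

open import Defs
open import Axiom.ExcludedMiddle using (ExcludedMiddle)
open import Axiom.Extensionality.Propositional using (Extensionality)
open import Data.Bool.Base as Bool using (Bool; true; false)
import Data.Bool.Properties as Bool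
open import Data.Empty using (⊥-elim-irr)
open import Data.Integer.Base using (ℤ; +_; -[1+_])
open import Data.Irrelevant using ([_])
open import Data.Nat.Base as ℕ using (ℕ; zero; suc)
import Data.Nat.Induction as ℕ
import Data.Nat.Properties as ℕ
open import Data.Product.Base using (Σ-syntax; ∃; ∃-syntax; _×_; _,_; proj₁; proj₂)
open import Data.Product.Relation.Binary.Lex.Strict
  using (×-Lex; ×-isStrictTotalOrder; ×-wellFounded)
open import Data.Product.Relation.Binary.Pointwise.NonDependent using (≡×≡⇒≡; ≡⇒≡×≡)
open import Data.Rational.Base as ℚ using (ℚ; mkℚ)
import Data.Rational.Properties as ℚ
open import Data.Refinement.Base using (Refinement-syntax; _,_; value)
open import Data.Refinement.Properties using (value-injective)
open import Data.Sum.Base using (_⊎_; inj₁; inj₂; [_,_]′)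
open import Data.Sum.Properties using (inj₁-injective; inj₂-injective)
open import Data.Sum.Relation.Binary.LeftOrder
  using (_⊎-<_; ₁∼₁; ₁∼₂; ₂∼₂; ⊎-<-isStrictTotalOrder; ⊎-<-isTotalOrder; ⊎-<-wellFounded)
import Data.Sum.Relation.Binary.Pointwise as PW
open import Data.Unit.Polymorphic.Base using (⊤; tt)
open import Function.Base using (_∋_; _∘_; _on_; flip; id)
open import Function.Bundles using (_↣_; mk⇔; mk↣; Equivalence; Injection; Bijection)
open import Function.Construct.Composition using (_↣-∘_)
open import Function.Definitions using (Injective)
open import Induction.WellFounded using (WellFounded; Acc; acc; module All; module FixPoint)
open import Level using (Level; _⊔_)
open import Relation.Binary.Construct.Add.Infimum.Strict as Infimum using (⊥₋<[_]; [_])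
import Relation.Binary.Construct.Flip.EqAndOrd as Flip
import Relation.Binary.Construct.NonStrictToStrict as ToStrict
import Relation.Binary.Construct.On as On
import Relation.Binary.Construct.StrictToNonStrict as ToNonStrict
open import Relation.Binary.Core using (Rel)
open import Relation.Binary.Definitions using (Transitive; Trichotomous; tri<; tri≈; tri>)
open import Relation.Binary.PropositionalEquality.Core
  using (_≡_; _≢_; refl; sym; trans; cong; cong₂; cong-app; subst; subst₂)
open import Relation.Binary.PropositionalEquality.Properties using (isEquivalence)
open import Relation.Binary.Structures using (IsTotalOrder; IsStrictTotalOrder)
open import Relation.Binary.Structures.Biased using (isStrictTotalOrderᶜ)
open import Relation.Nullary.Construct.Add.Infimum using (_₋; ⊥₋; [_])
open import Relation.Nullary.Decidable.Core using (Dec; yes; no; decidable-stable)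
open import Relation.Nullary.Negation.Core using (¬_; contradiction)
open import Relation.Unary using (Pred; _∈_; _∉_; _⊆_; U; Satisfiable; _⟨×⟩_)

-- The chains and the antichain are all given by one construction.  Let I be a
-- linear order with a map code : I → κ.  To a subset S of I on which code is
-- injective assign
--
--   Σ S  =  κ  +  (sum over i ∈ S of  ℚ copies of E i),
--
-- where E i is the well-ordered set of all x ≤ code i in κ.  This order has
-- size κ by Hessenberg's theorem (κ×κ↣κ) and the Schröder-Bernstein theorem,
-- so it can be given the domain κ.  Two facts carry the argument.
--
-- If S is an initial segment of T, then Σ S is an initial segment of Σ T, hence
-- Σ S ⊴ Σ T with a partition into one part (initial⇒⊴).
--
-- Conversely Σ S ⊴ Σ T implies S ⊆ T (⊴⇒⊆).  Given i ∈ S, take one point in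
-- each of the ℚ copies of E i.  These points cannot lie in pairwise different
-- parts, since otherwise ℚ would embed in the scattered order that indexes the
-- partition.  So two of them, q₀ < q₁, lie in one part, and the interval between
-- them is mapped onto an interval of Σ T.  The copies of the E j are visible in
-- the order: two points are in the same copy, where the leading κ counts as one,
-- exactly when the interval between them is well-ordered, because between
-- different copies there is always another one.  Hence a copy of E i strictly
-- between those of q₀ and q₁ is mapped onto a full copy of some E j with j ∈ T.
-- Isomorphic initial segments of a well-order are equal, so code i = code j and
-- therefore i = j (transfers-code).
--
-- For a linear order M take I = M and assign to x the set of all z ≤ x.
-- For ℝκ take I = ℝκ and assign to x the functions of bounded support in the
-- lower cut of x; under κ^{<κ} = κ there are only κ such functions, and they
-- separate the points of ℝκ.  For the antichain take I = κ × Bool and assign to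
-- F : κ → Bool its graph.

private
  variable
    a b c p q r s : Level
    A : Set a
    B : Set b
    C : Set c

-- Orders with respect to propositional equality

×-isStrictTotalOrder-≡ : {_<₁_ : Rel A p} {_<₂_ : Rel B q} →
  IsStrictTotalOrder _≡_ _<₁_ → IsStrictTotalOrder _≡_ _<₂_ →
  IsStrictTotalOrder _≡_ (×-Lex _≡_ _<₁_ _<₂_)
×-isStrictTotalOrder-≡ {_<₁_ = _<₁_} {_<₂_} sto₁ sto₂ = isStrictTotalOrderᶜ record
  { isEquivalence = isEquivalence
  ; trans         = lex.trans
  ; compare       = compare
  }
  where
  module lex = IsStrictTotalOrder (×-isStrictTotalOrder sto₁ sto₂)
  compare : Trichotomous _≡_ (×-Lex _≡_ _<₁_ _<₂_)
  compare x y with lex.compare x y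
  ... | tri< l ¬e ¬g = tri< l (¬e ∘ ≡⇒≡×≡) ¬g
  ... | tri≈ ¬l e ¬g = tri≈ ¬l (≡×≡⇒≡ e) ¬g
  ... | tri> ¬l ¬e g = tri> ¬l (¬e ∘ ≡⇒≡×≡) g

⊎-isStrictTotalOrder-≡ : {_<₁_ : Rel A p} {_<₂_ : Rel B q} →
  IsStrictTotalOrder _≡_ _<₁_ → IsStrictTotalOrder _≡_ _<₂_ →
  IsStrictTotalOrder _≡_ (_<₁_ ⊎-< _<₂_)
⊎-isStrictTotalOrder-≡ {_<₁_ = _<₁_} {_<₂_} sto₁ sto₂ = isStrictTotalOrderᶜ record
  { isEquivalence = isEquivalence
  ; trans         = sum.trans
  ; compare       = compare
  }
  where
  module sum = IsStrictTotalOrder (⊎-<-isStrictTotalOrder sto₁ sto₂)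
  compare : Trichotomous _≡_ (_<₁_ ⊎-< _<₂_)
  compare x y with sum.compare x y
  ... | tri< l ¬e ¬g = tri< l (¬e ∘ PW.≡⇒Pointwise-≡) ¬g
  ... | tri≈ ¬l e ¬g = tri≈ ¬l (PW.Pointwise-≡⇒≡ e) ¬g
  ... | tri> ¬l ¬e g = tri> ¬l (¬e ∘ PW.≡⇒Pointwise-≡) g

-- Injections between subsets

-- D ≲ E: some function maps the subset D injectively into the subset E.
-- It is defined on the whole ambient type, with unconstrained values outside D,
-- so that no subtypes need to be formed.

record _≲_ {A : Set a} {B : Set b} (D : Pred A p) (E : Pred B q) :
           Set (a ⊔ b ⊔ p ⊔ q) where
  field
    to        : A → B
    maps      : ∀ {x} → x ∈ D → to x ∈ E
    injective : ∀ {x y} → x ∈ D → y ∈ D → to x ≡ to y → x ≡ y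

infix 1 _≲_

≲-trans : {D : Pred A p} {E : Pred B q} {F : Pred C r} → D ≲ E → E ≲ F → D ≲ F
≲-trans f g = record
  { to        = g.to ∘ f.to
  ; maps      = g.maps ∘ f.maps
  ; injective = λ x y → f.injective x y ∘ g.injective (f.maps x) (f.maps y)
  }
  where
  module f = _≲_ f
  module g = _≲_ g

≲-× : {D : Pred A p} {E : Pred B q} → D ≲ E → D ⟨×⟩ D ≲ E ⟨×⟩ E
≲-× f = record
  { to        = λ (x , y) → to x , to y
  ; maps      = λ (x , y) → maps x , maps y
  ; injective = λ (x , y) (x′ , y′) e → cong₂ _,_ (injective x x′ (cong proj₁ e))
                                                  (injective y y′ (cong proj₂ e))
  }
  where open _≲_ f

⊆⇒≲ : {D : Pred A p} {E : Pred A q} → D ⊆ E → D ≲ E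
⊆⇒≲ D⊆E = record { to = id ; maps = D⊆E ; injective = λ _ _ → id }

-- A bijection from the type A onto the subset D.

record Enumeration (A : Set a) {B : Set b} (D : Pred B p) : Set (a ⊔ b ⊔ p) where
  field
    at        : A → B
    injective : Injective _≡_ _≡_ at
    lands     : ∀ x → at x ∈ D
    onto      : ∀ {y} → y ∈ D → ∃[ x ] at x ≡ y

-- Countable sets

ℕ×ℕ↣ℕ : (ℕ × ℕ) ↣ ℕ
ℕ×ℕ↣ℕ = mk↣ λ {x} {y} → injective x y
  where
  -- The pair (m , n) is coded by 2 ^ m * (2 * n + 1).
  code : ℕ × ℕ → ℕ
  code (zero  , n) = suc (2 ℕ.* n)
  code (suc m , n) = 2 ℕ.* code (m , n)

  injective : ∀ x y → code x ≡ code y → x ≡ y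
  injective (zero , n) (zero , n′) e = cong (zero ,_) (ℕ.*-cancelˡ-≡ n n′ 2 (ℕ.suc-injective e))
  injective (zero , n) (suc m′ , n′) e = contradiction (sym e) (ℕ.even≢odd (code (m′ , n′)) n)
  injective (suc m , n) (zero , n′) e = contradiction e (ℕ.even≢odd (code (m , n)) n′)
  injective (suc m , n) (suc m′ , n′) e
    with refl ← injective (m , n) (m′ , n′) (ℕ.*-cancelˡ-≡ (code (m , n)) (code (m′ , n′)) 2 e) = refl

ℤ↣ℕ : ℤ ↣ ℕ
ℤ↣ℕ = mk↣ λ {x} {y} → injective x y
  where
  code : ℤ → ℕ
  code (+ n)    = 2 ℕ.* n
  code -[1+ n ] = suc (2 ℕ.* n)

  injective : ∀ x y → code x ≡ code y → x ≡ y
  injective (+ m)    (+ n)    e = cong +_ (ℕ.*-cancelˡ-≡ m n 2 e)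
  injective (+ m)    -[1+ n ] e = contradiction e (ℕ.even≢odd m n)
  injective -[1+ m ] (+ n)    e = contradiction (sym e) (ℕ.even≢odd n m)
  injective -[1+ m ] -[1+ n ] e = cong -[1+_] (ℕ.*-cancelˡ-≡ m n 2 (ℕ.suc-injective e))

×-↣ : {D : Set r} → A ↣ C → B ↣ D → (A × B) ↣ (C × D)
×-↣ f g = mk↣ {to = λ (x , y) → Injection.to f x , Injection.to g y}
  λ e → cong₂ _,_ (Injection.injective f (cong proj₁ e)) (Injection.injective g (cong proj₂ e))

ℚ↣ℕ : ℚ ↣ ℕ
ℚ↣ℕ = ℕ×ℕ↣ℕ ↣-∘ (×-↣ ℤ↣ℕ (mk↣ id) ↣-∘ fraction)
  where
  fraction : ℚ ↣ (ℤ × ℕ)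
  fraction = mk↣ {to = λ x → ℚ.numerator x , ℚ.denominator-1 x}
    λ { {mkℚ _ _ _} {mkℚ _ _ _} refl → refl }

Bool↣ℕ : Bool ↣ ℕ
Bool↣ℕ = mk↣ {to = λ { false → 0 ; true → 1 }}
  λ { {false} {false} _ → refl ; {true} {true} _ → refl }

-- Well-ordered intervals

-- WellFoundedInterval L x y, for x ≤ y: every element of the closed interval
-- from x to y is accessible within the interval, that is, the interval is
-- well-ordered.

WellFoundedInterval : (L : LO A) → A → A → Set _
WellFoundedInterval L x = Acc λ u v → x ≤ u × ¬ (v ≤ u)
  where open LO L

-- An embedding reflects well-ordered intervals, and preserves them if its range
-- has no gaps in the interval between the images.

module _ {L : LO A} {M : LO B} {f : A → B} (f-emb : IsEmbedding L M f) where

  private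
    module L = LO L
    module M = LO M

  reflect-interval : ∀ {x y} → WellFoundedInterval M (f x) (f y) → WellFoundedInterval L x y
  reflect-interval (acc rec) = acc λ (x≤u , y≰u) →
    reflect-interval (rec (Equivalence.to (f-emb _ _) x≤u , y≰u ∘ Equivalence.from (f-emb _ _)))

  preserve-interval : ∀ {x y} →
    (∀ {w} → f x M.≤ w → w M.≤ f y → ∃[ z ] f z ≡ w) →
    WellFoundedInterval L x y → WellFoundedInterval M (f x) (f y)
  preserve-interval {x} {y} fills (acc rec) = acc λ {w} (fx≤w , fy≰w) → below fx≤w fy≰w
    where
    below : ∀ {w} → f x M.≤ w → ¬ (f y M.≤ w) → WellFoundedInterval M (f x) w
    below {w} fx≤w fy≰w with IsTotalOrder.total M.isTotalOrder (f y) w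
    ... | inj₁ fy≤w = contradiction fy≤w fy≰w
    ... | inj₂ w≤fy with fills fx≤w w≤fy
    ...   | z , refl = preserve-interval
      (λ fx≤v v≤fz → fills fx≤v (IsTotalOrder.trans M.isTotalOrder v≤fz w≤fy))
      (rec (Equivalence.from (f-emb x z) fx≤w , fy≰w ∘ Equivalence.to (f-emb y z)))

-- Rigidity of well-orders

-- If R is a strictly increasing correspondence between the closed initial
-- segments up to i and up to j, then R is the identity.

module _ {κ : Set a} {_<_ : Rel κ b} (sto : IsStrictTotalOrder _≡_ _<_) (wf : WellFounded _<_) where

  open IsStrictTotalOrder sto using (compare; irrefl) renaming (trans to <-trans)

  correspondence⇒identity :
    ∀ {i j} (R : Rel κ r) →
    (∀ {x} → ¬ (i < x) → ∃[ y ] ¬ (j < y) × R x y) →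
    (∀ {y} → ¬ (j < y) → ∃[ x ] ¬ (i < x) × R x y) →
    (∀ {x y x′ y′} → R x y → R x′ y′ → x < x′ → y < y′) →
    (∀ {x y x′ y′} → R x y → R x′ y′ → y < y′ → x < x′) →
    ∀ {x y} → ¬ (i < x) → ¬ (j < y) → R x y → x ≡ y
  correspondence⇒identity {i = i} {j} R total onto mono reflects {x} = go (wf x)
    where
    go : ∀ {x} → Acc _<_ x → ∀ {y} → ¬ (i < x) → ¬ (j < y) → R x y → x ≡ y
    go {x} (acc rec) {y} i≮x j≮y Rxy with compare x y
    ... | tri≈ _ x≡y _ = x≡y
    ... | tri< x<y _ _ =
      let z , i≮z , Rzx = onto λ j<x → j≮y (<-trans j<x x<y)
          z<x = reflects Rzx Rxy x<y
      in contradiction z<x (irrefl (go (rec z<x) i≮z (λ j<x → j≮y (<-trans j<x x<y)) Rzx))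
    ... | tri> _ _ y<x =
      let w , j≮w , Ryw = total λ i<y → i≮x (<-trans i<y y<x)
          w<y = mono Ryw Rxy y<x
      in contradiction w<y (irrefl (sym (go (rec y<x) (λ i<y → i≮x (<-trans i<y y<x)) j≮w Ryw)))

  correspondence⇒≡ :
    ∀ {i j} (R : Rel κ r) →
    (∀ {x} → ¬ (i < x) → ∃[ y ] ¬ (j < y) × R x y) →
    (∀ {y} → ¬ (j < y) → ∃[ x ] ¬ (i < x) × R x y) →
    (∀ {x y x′ y′} → R x y → R x′ y′ → x < x′ → y < y′) →
    (∀ {x y x′ y′} → R x y → R x′ y′ → y < y′ → x < x′) →
    i ≡ j
  correspondence⇒≡ {i = i} {j} R total onto mono reflects with compare i j
  ... | tri≈ _ i≡j _ = i≡j
  ... | tri< i<j _ _ =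
    let x , i≮x , Rxj = onto (irrefl refl)
    in contradiction (subst (i <_) (sym (identity i≮x (irrefl refl) Rxj)) i<j) i≮x
    where identity = correspondence⇒identity R total onto mono reflects
  ... | tri> _ _ j<i =
    let y , j≮y , Riy = total (irrefl refl)
    in contradiction (subst (j <_) (identity (irrefl refl) j≮y Riy) j<i) j≮y
    where identity = correspondence⇒identity R total onto mono reflects

-- Cardinal arithmetic

-- Under excluded middle for all types, a witness can be extracted from any
-- inhabited type, so that choice is available.

module Classical (em : ∀ {a} → ExcludedMiddle a) (ext : ∀ {a b} → Extensionality a b) where

  by-contradiction : ¬ ¬ A → A
  by-contradiction = decidable-stable em

  -- The choice of an element y with R x y for each x in D, made by excluded
  -- middle on Σ-types, as an injection on D.

  choice : {D : Pred A p} {E : Pred B q} (R : A → B → Set r) → B →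
           (∀ {x} → x ∈ D → ∃[ y ] y ∈ E × R x y) →
           (∀ {x x′ y} → R x y → R x′ y → x ≡ x′) →
           D ≲ E
  choice {A = A} {B = B} {D = D} {E} R default total functional = record
    { to        = λ x → pick x em
    ; maps      = λ {x} x∈D → proj₁ (picked em x∈D)
    ; injective = λ {x} {y} x∈D y∈D e →
        functional (proj₂ (picked em x∈D)) (subst (R y) (sym e) (proj₂ (picked em y∈D)))
    }
    where
    pick : ∀ x → Dec (x ∈ D) → B
    pick x (yes x∈D) = proj₁ (total x∈D)
    pick x (no  _)   = default

    picked : ∀ {x} (d : Dec (x ∈ D)) → x ∈ D → pick x d ∈ E × R x (pick x d)
    picked (yes x∈D) _   = proj₂ (total x∈D)
    picked (no  x∉D) x∈D = contradiction x∈D x∉D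

  module SchröderBernstein {A : Set a} {B : Set b} {D : Pred B p}
                           (f : U {A = A} ≲ D) (g : D ≲ U {A = A}) where

    module f = _≲_ f
    module g = _≲_ g

    -- The points reached from outside the range of g by iterating g ∘ f.
    data Chain : Pred A (a ⊔ b ⊔ p) where
      start : ∀ {x} → ¬ (∃[ y ] y ∈ D × g.to y ≡ x) → Chain x
      step  : ∀ {x} → Chain x → Chain (g.to (f.to x))

    Side : A → Set _
    Side x = Chain x ⊎ (¬ Chain x × ∃[ y ] y ∈ D × g.to y ≡ x)

    side : ∀ x → Side x
    side x with em {P = Chain x}
    ... | yes c = inj₁ c
    ... | no ¬c = inj₂ (¬c , by-contradiction (¬c ∘ start))

    -- Apply f on Chain and the inverse of g elsewhere.
    at : ∀ {x} → Side x → B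
    at {x} (inj₁ _)           = f.to x
    at     (inj₂ (_ , y , _)) = y

    lands : ∀ {x} (i : Side x) → at i ∈ D
    lands (inj₁ _)                 = f.maps _
    lands (inj₂ (_ , _ , y∈D , _)) = y∈D

    at-injective : ∀ {x y} (i : Side x) (j : Side y) → at i ≡ at j → x ≡ y
    at-injective (inj₁ _) (inj₁ _) e = f.injective _ _ e
    at-injective (inj₁ c) (inj₂ (¬c , y , _ , gy≡)) e =
      contradiction (subst Chain (trans (cong g.to e) gy≡) (step c)) ¬c
    at-injective (inj₂ (¬c , y , _ , gy≡)) (inj₁ c) e =
      contradiction (subst Chain (trans (cong g.to (sym e)) gy≡) (step c)) ¬c
    at-injective (inj₂ (_ , _ , _ , e₁)) (inj₂ (_ , _ , _ , e₂)) e =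
      trans (sym e₁) (trans (cong g.to e) e₂)

    on-chain : ∀ {x} → Chain x → (i : Side x) → at i ≡ f.to x
    on-chain c (inj₁ _)        = refl
    on-chain c (inj₂ (¬c , _)) = contradiction c ¬c

    onto : ∀ {y} → y ∈ D → ∃[ x ] at (side x) ≡ y
    onto {y} y∈D with side (g.to y) in eq
    ... | inj₂ (_ , y′ , y′∈D , e) = g.to y , trans (cong at eq) (g.injective y′∈D y∈D e)
    ... | inj₁ c = pred c refl
      where
      pred : ∀ {z} → Chain z → z ≡ g.to y → ∃[ x ] at (side x) ≡ y
      pred (start n)    e = contradiction (y , y∈D , sym e) n
      pred (step {x} c) e = x , trans (on-chain c (side x)) (g.injective (f.maps _) y∈D e)

    enumeration : Enumeration A D
    enumeration = record
      { at        = λ x → at (side x)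
      ; injective = λ {x} {y} → at-injective (side x) (side y)
      ; lands     = λ x → lands (side x)
      ; onto      = onto
      }

  -- Gödel's well-ordering of the square of a well-order: pairs are compared
  -- by their maximum first, then lexicographically.

  module GödelOrder {N : Set a} {_<_ : Rel N b}
                    (sto : IsStrictTotalOrder _≡_ _<_) (wf : WellFounded _<_) where

    open IsStrictTotalOrder sto using (compare; asym; irrefl) renaming (trans to <-trans)

    max : N → N → N
    max x y with compare x y
    ... | tri< _ _ _ = y
    ... | tri≈ _ _ _ = x
    ... | tri> _ _ _ = x

    max-sel : {P : Pred N p} → ∀ {x y} → x ∈ P → y ∈ P → max x y ∈ P
    max-sel {x = x} {y} px py with compare x y
    ... | tri< _ _ _ = py
    ... | tri≈ _ _ _ = px
    ... | tri> _ _ _ = px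

    max-ub : ∀ x y → ¬ (max x y < x) × ¬ (max x y < y)
    max-ub x y with compare x y
    ... | tri< x<y _ _ = asym x<y , irrefl refl
    ... | tri≈ ¬l _ ¬g = irrefl refl , ¬l
    ... | tri> ¬l _ _  = irrefl refl , ¬l

    key : N × N → N × (N × N)
    key (x , y) = max x y , x , y

    key-sto : IsStrictTotalOrder _≡_ (×-Lex _≡_ _<_ (×-Lex _≡_ _<_ _<_))
    key-sto = ×-isStrictTotalOrder-≡ sto (×-isStrictTotalOrder-≡ sto sto)

    _≺_ : Rel (N × N) _
    _≺_ = ×-Lex _≡_ _<_ (×-Lex _≡_ _<_ _<_) on key

    ≺-wellFounded : WellFounded _≺_
    ≺-wellFounded = On.wellFounded key (×-wellFounded wf (×-wellFounded wf wf))

    AtMost : N → Pred N _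
    AtMost m x = ¬ (m < x)

    ≺-below : ∀ {x y} → y ≺ x →
              y ∈ (AtMost (max (proj₁ x) (proj₂ x)) ⟨×⟩ AtMost (max (proj₁ x) (proj₂ x)))
    ≺-below {x} {y} y≺x = below y≺x (proj₁ (max-ub _ _)) , below y≺x (proj₂ (max-ub _ _))
      where
      below : ∀ {z} → y ≺ x → ¬ (max (proj₁ y) (proj₂ y) < z) → ¬ (max (proj₁ x) (proj₂ x) < z)
      below (inj₁ my<mx)       my≮z mx<z = my≮z (<-trans my<mx mx<z)
      below (inj₂ (my≡mx , _)) my≮z mx<z = my≮z (subst (_< _) (sym my≡mx) mx<z)

    -- If D does not inject into the square of any initial segment determined
    -- by one of its elements, then the pairs in D can be mapped to D one
    -- after the other, each to an element not yet used.
    square : (D : Pred N p) →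
             (∀ {m} → m ∈ D → ¬ (D ≲ AtMost m ⟨×⟩ AtMost m)) →
             D ⟨×⟩ D ≲ D
    square D large = record { to = f ; maps = λ p∈ → proj₁ (f-fresh p∈) ; injective = f-injective }
      where
      D² = D ⟨×⟩ D

      -- The elements of D that g does not take as a value at a pair in D.
      Fresh : ∀ x → (∀ {y} → y ≺ x → N) → N → Set _
      Fresh x g w = w ∈ D × (∀ {y} (y≺x : y ≺ x) → y ∈ D² → w ≢ g y≺x)

      decide : ∀ {x} {g : ∀ {y} → y ≺ x → N} → Dec (∃ (Fresh x g)) → N
      decide     (yes (w , _)) = w
      decide {x} (no _)        = proj₁ x

      next : ∀ x → (∀ {y} → y ≺ x → N) → N
      next x g = decide {x} {g} em

      next-cong : ∀ x {g h : ∀ {y} → y ≺ x → N} → (∀ {y} (l : y ≺ x) → g l ≡ h l) → next x g ≡ next x h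
      next-cong x {g} {h} e = cong (λ (k : ∀ y → y ≺ x → N) → next x (λ {y} → k y))
                                   (ext λ y → ext λ l → e {y} l)

      f : N × N → N
      f = All.wfRec ≺-wellFounded _ (λ _ → N) next

      f-unfold : ∀ x → f x ≡ next x (λ {y} _ → f y)
      f-unfold x = FixPoint.unfold-wfRec ≺-wellFounded (λ _ → N) next next-cong {x}

      exists : ∀ {x} → x ∈ D² → ∃ (Fresh x (λ {y} _ → f y))
      exists {x@(u , v)} (u∈D , v∈D) = by-contradiction λ none →
        large (max-sel {P = D} u∈D v∈D)
          (choice (λ w y → w ≡ f y) x
            (λ {w} w∈D → by-contradiction λ unused → none
              (w , w∈D , λ {y} y≺x y∈D² w≡fy → unused (y , ≺-below {x} {y} y≺x , w≡fy)))
            (λ e e′ → trans e (sym e′)))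

      f-fresh : ∀ {x} → x ∈ D² → Fresh x (λ {y} _ → f y) (f x)
      f-fresh {x} x∈D² = subst (Fresh x _) (sym (f-unfold x)) (decided em)
        where
        decided : (d : Dec (∃ (Fresh x (λ {y} _ → f y)))) → Fresh x (λ {y} _ → f y) (decide d)
        decided (yes (_ , fresh)) = fresh
        decided (no none)         = contradiction (exists x∈D²) none

      f-injective : ∀ {x y} → x ∈ D² → y ∈ D² → f x ≡ f y → x ≡ y
      f-injective {x} {y} x∈ y∈ e with IsStrictTotalOrder.compare key-sto (key x) (key y)
      ... | tri< l _ _  = contradiction (sym e) (proj₂ (f-fresh y∈) l x∈)
      ... | tri≈ _ k≡ _ = cong proj₂ k≡
      ... | tri> _ _ g  = contradiction e (proj₂ (f-fresh x∈) g y∈)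

  -- Hessenberg's theorem: an infinite well-ordered set κ satisfies κ · κ = κ.
  -- The induction is on the initial segments of ω + κ that contain ω, so that
  -- all of them are infinite.

  module Hessenberg {κ : Set a} {_<_ : Rel κ b}
                    (sto : IsStrictTotalOrder _≡_ _<_) (wf : WellFounded _<_) where

    open IsStrictTotalOrder sto using (compare)
    open Infimum _<_ using (_<₋_; <₋-wellFounded)

    N : Set _
    N = ℕ ⊎ κ

    _<ᴺ_ : Rel N _
    _<ᴺ_ = ℕ._<_ ⊎-< _<_

    open GödelOrder (⊎-isStrictTotalOrder-≡ ℕ.<-isStrictTotalOrder sto)
                    (⊎-<-wellFounded ℕ.<-wellFounded wf)
      using (AtMost; square)

    -- The segment Seg (rank m) consists of ω and the elements below m.

    rank : N → κ ₋
    rank (inj₁ n) = ⊥₋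
    rank (inj₂ β) = [ β ]

    -- The initial segment ω + α, with ω itself as the value at the infimum.
    Seg : κ ₋ → Pred N _
    Seg α (inj₁ n) = ⊤ {a ⊔ b}
    Seg α (inj₂ β) = [ β ] <₋ α

    AtMost≲Seg : ∀ m → AtMost m ≲ Seg (rank m)
    AtMost≲Seg (inj₁ n) = ⊆⇒≲ λ { {inj₁ _} _ → tt ; {inj₂ _} m≮ → contradiction ₁∼₂ m≮ }
    -- The element β itself is mapped to 0, and ω is shifted by one.
    AtMost≲Seg (inj₂ β) = record
      { to        = λ x → shift x em
      ; maps      = λ {x} x∈ → shift-maps x em x∈
      ; injective = λ {x} {y} _ _ → shift-injective x y em em
      }
      where
      shift : ∀ x → Dec (x ≡ inj₂ β) → N
      shift _        (yes _) = inj₁ 0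
      shift (inj₁ n) (no _)  = inj₁ (suc n)
      shift (inj₂ γ) (no _)  = inj₂ γ

      shift-maps : ∀ x d → x ∈ AtMost (inj₂ β) → shift x d ∈ Seg [ β ]
      shift-maps _        (yes _) _ = tt
      shift-maps (inj₁ n) (no _)  _ = tt
      shift-maps (inj₂ γ) (no γ≢β) β≮γ with compare γ β
      ... | tri< γ<β _ _ = [ γ<β ]
      ... | tri≈ _ γ≡β _ = contradiction (cong inj₂ γ≡β) γ≢β
      ... | tri> _ _ β<γ = contradiction (₂∼₂ β<γ) β≮γ

      shift-injective : ∀ x y d d′ → shift x d ≡ shift y d′ → x ≡ y
      shift-injective _        _        (yes e) (yes e′) _    = trans e (sym e′)
      shift-injective _        (inj₁ _) (yes _) (no _)   ()
      shift-injective _        (inj₂ _) (yes _) (no _)   ()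
      shift-injective (inj₁ _) _        (no _)  (yes _)  ()
      shift-injective (inj₂ _) _        (no _)  (yes _)  ()
      shift-injective (inj₁ _) (inj₁ _) (no _)  (no _)   refl = refl
      shift-injective (inj₂ _) (inj₂ _) (no _)  (no _)   e    = e

    -- A set that injects into one of the segments below its elements inherits
    -- the square of that segment; otherwise the greedy map of square exists.

    square-step : (D : Pred N p) →
                  (∀ {m} → m ∈ D → Seg (rank m) ⊆ D) →
                  (∀ {m} → m ∈ D → Seg (rank m) ⟨×⟩ Seg (rank m) ≲ Seg (rank m)) →
                  D ⟨×⟩ D ≲ D
    square-step D closed ih with em {P = ∃[ m ] m ∈ D × (D ≲ Seg (rank m))}
    ... | yes (m , m∈D , small) = ≲-trans (≲-× small) (≲-trans (ih m∈D) (⊆⇒≲ (closed m∈D)))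
    ... | no large = square D λ {m} m∈D D≲ →
      large (m , m∈D , ≲-trans D≲ (≲-trans (≲-× (AtMost≲Seg m)) (ih m∈D)))

    ω-square : Seg ⊥₋ ⟨×⟩ Seg ⊥₋ ≲ Seg ⊥₋
    ω-square = record
      { to        = λ (x , y) → inj₁ (Injection.to ℕ×ℕ↣ℕ (index x , index y))
      ; maps      = λ _ → tt
      ; injective = λ { {inj₁ _ , inj₁ _} {inj₁ _ , inj₁ _} _ _ e →
                          cong (λ (m , n) → inj₁ m , inj₁ n) (Injection.injective ℕ×ℕ↣ℕ (inj₁-injective e)) }
      }
      where
      index : N → ℕ
      index (inj₁ n) = n
      index (inj₂ _) = 0

    segment-square : ∀ α → Seg α ⟨×⟩ Seg α ≲ Seg α
    segment-square α = go α (<₋-wellFounded wf α)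
      where
      go : ∀ α → Acc _<₋_ α → Seg α ⟨×⟩ Seg α ≲ Seg α
      go ⊥₋    _         = ω-square
      go [ α ] (acc rec) = square-step (Seg [ α ])
        (λ { {inj₁ _} _ {inj₁ _} _ → tt
           ; {inj₂ _} _ {inj₁ _} _ → tt
           ; {inj₂ _} l {inj₂ _} l′ → Infimum.<₋-trans _<_ (IsStrictTotalOrder.trans sto) l′ l })
        (λ { {inj₁ n} _ → ω-square ; {inj₂ β} l → go [ β ] (rec l) })

    N×N≲N : U {A = N × N} ≲ U {A = N}
    N×N≲N = ≲-trans (⊆⇒≲ _) (square-step U _ (λ {m} _ → segment-square (rank m)))

    -- ℵ₀ + κ ≤ κ: the range of the given sequence in κ is split into the terms
    -- of even and of odd index.

    absorb : ℕ ↣ κ → N ↣ κ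
    absorb i = mk↣ λ {x} {y} → injective x y (λ _ → em) (λ _ → em)
      where
      open Injection i using () renaming (to to ι; injective to ι-injective)

      place : ∀ x → Dec (∃[ n ] ι n ≡ x) → κ
      place x (yes (n , _)) = ι (suc (2 ℕ.* n))
      place x (no _)        = x

      to : (x : N) → (∀ y → Dec (∃[ n ] ι n ≡ y)) → κ
      to (inj₁ n) _ = ι (2 ℕ.* n)
      to (inj₂ x) d = place x (d x)

      injective : ∀ x y d d′ → to x d ≡ to y d′ → x ≡ y
      injective (inj₁ m) (inj₁ n) _ _ e = cong inj₁ (ℕ.*-cancelˡ-≡ m n 2 (ι-injective e))
      injective (inj₁ m) (inj₂ y) _ d e with d y
      ... | yes (n , _) = contradiction (ι-injective e) (ℕ.even≢odd m n)
      ... | no y∉       = contradiction (_ , e) y∉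
      injective (inj₂ x) (inj₁ n) d _ e with d x
      ... | yes (m , _) = contradiction (sym (ι-injective e)) (ℕ.even≢odd n m)
      ... | no x∉       = contradiction (_ , sym e) x∉
      injective (inj₂ x) (inj₂ y) d d′ e with d x | d′ y
      ... | no _ | no _ = cong inj₂ e
      ... | no x∉ | yes _ = contradiction (_ , sym e) x∉
      ... | yes _ | no y∉ = contradiction (_ , e) y∉
      ... | yes (m , refl) | yes (n , refl) =
        cong (inj₂ ∘ ι) (ℕ.*-cancelˡ-≡ m n 2 (ℕ.suc-injective (ι-injective e)))

    κ×κ↣κ : ℕ ↣ κ → (κ × κ) ↣ κ
    κ×κ↣κ i = mk↣ λ {x} {y} e →
      let e′ = _≲_.injective N×N≲N {pair x} {pair y} _ _ (Injection.injective (absorb i) e)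
      in cong₂ _,_ (inj₂-injective (cong proj₁ e′)) (inj₂-injective (cong proj₂ e′))
      where
      pair : κ × κ → N × N
      pair (x , y) = inj₂ x , inj₂ y

  -- Sums of well-orders over a dense order

  -- The summands live in Block × κ, ordered lexicographically, where a block is
  -- a pair (i , q) with i ∈ I and q ∈ ℚ, or an additional least block.

  module Sum {κ I : Set a} {_<_ : Rel κ a} {_<ᴵ_ : Rel I a}
             (<-sto : IsStrictTotalOrder _≡_ _<_) (<-wf : WellFounded _<_)
             (<ᴵ-sto : IsStrictTotalOrder _≡_ _<ᴵ_) (code : I → κ) where

    private
      module κ = IsStrictTotalOrder <-sto
      module I = IsStrictTotalOrder <ᴵ-sto

    open Infimum (×-Lex _≡_ _<ᴵ_ ℚ._<_) using (_<₋_; <₋-isStrictTotalOrder-≡)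

    Block : Set a
    Block = (I × ℚ) ₋

    blocks : IsStrictTotalOrder _≡_ _<₋_
    blocks = <₋-isStrictTotalOrder-≡ (×-isStrictTotalOrder-≡ <ᴵ-sto ℚ.<-isStrictTotalOrder)

    private module Bl = IsStrictTotalOrder blocks

    Point : Set a
    Point = Block × κ

    _<ᴾ_ : Rel Point a
    _<ᴾ_ = ×-Lex _≡_ _<₋_ _<_

    points : IsStrictTotalOrder _≡_ _<ᴾ_
    points = ×-isStrictTotalOrder-≡ blocks <-sto

    private module Pt = IsStrictTotalOrder points

    open ToNonStrict _≡_ _<ᴾ_ using () renaming (_≤_ to _≤ᴾ_)
    module ≤ᴾ = IsTotalOrder (ToNonStrict.isTotalOrder _≡_ _<ᴾ_ points)

    -- Support S consists of a copy of κ in the least block and, for i ∈ S and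
    -- q ∈ ℚ, of a copy of the closed initial segment up to code i in the block
    -- (i , q).

    Support : Pred I s → Pred Point _
    Support {s = s} S (⊥₋        , x) = ⊤ {a ⊔ s}
    Support         S ([ i , q ] , x) = i ∈ S × ¬ (code i < x)

    -- The lexicographic order of Support S, transferred to κ.

    order : {S : Pred I s} → Enumeration κ (Support S) → LO κ
    order e = record
      { _≤_          = _≤ᴾ_ on at
      ; isTotalOrder = record
        { isPartialOrder = record
          { isPreorder = record
            { isEquivalence = isEquivalence
            ; reflexive     = λ x≡y → ≤ᴾ.reflexive (cong at x≡y)
            ; trans         = ≤ᴾ.trans
            }
          ; antisym = λ x≤y y≤x → injective (≤ᴾ.antisym x≤y y≤x)
          }
        ; total = λ x y → ≤ᴾ.total (at x) (at y)
        }
      }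
      where open Enumeration e

    block-mono : ∀ {u v} → u ≤ᴾ v → ¬ (proj₁ v <₋ proj₁ u)
    block-mono (inj₁ (inj₁ l))       g = Bl.asym l g
    block-mono (inj₁ (inj₂ (e , _))) g = Bl.irrefl (sym e) g
    block-mono (inj₂ refl)           g = Bl.irrefl refl g

    block-sandwich : ∀ {u v w} → u ≤ᴾ v → v ≤ᴾ w → proj₁ u ≡ proj₁ w → proj₁ v ≡ proj₁ w
    block-sandwich {u} {v} {w} u≤v v≤w e with Bl.compare (proj₁ v) (proj₁ w)
    ... | tri< l _ _  = contradiction (subst (proj₁ v <₋_) (sym e) l) (block-mono u≤v)
    ... | tri≈ _ e′ _ = e′
    ... | tri> _ _ g  = contradiction g (block-mono v≤w)

    ≰⇒> : ∀ {u v} → ¬ (v ≤ᴾ u) → u <ᴾ v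
    ≰⇒> {u} {v} v≰u with Pt.compare u v
    ... | tri< l _ _ = l
    ... | tri≈ _ e _ = contradiction (inj₂ (sym e)) v≰u
    ... | tri> _ _ g = contradiction (inj₁ g) v≰u

    <⇒≱ : ∀ {u v} → u <ᴾ v → ¬ (v ≤ᴾ u)
    <⇒≱ u<v (inj₁ v<u) = Pt.asym u<v v<u
    <⇒≱ u<v (inj₂ e)   = Pt.irrefl (sym e) u<v

    <-in-block : ∀ {u v} → proj₁ u ≡ proj₁ v → u <ᴾ v → proj₂ u < proj₂ v
    <-in-block e (inj₁ l)       = contradiction l (Bl.irrefl e)
    <-in-block e (inj₂ (_ , l)) = l

    -- Below a block (j , s) and above β there is a block (j , r).

    between-blocks : ∀ {β j s} → β <₋ [ j , s ] → ∃[ r ] β <₋ [ j , r ] × r ℚ.< s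
    between-blocks {j = j} {s} l = go l
      where
      s-1<s : s ℚ.- ℚ.1ℚ ℚ.< s
      s-1<s = subst (s ℚ.- ℚ.1ℚ ℚ.<_) (ℚ.+-identityʳ s) (ℚ.+-monoʳ-< s (ℚ.negative⁻¹ (ℚ.- ℚ.1ℚ)))

      go : ∀ {β} → β <₋ [ j , s ] → ∃[ r ] β <₋ [ j , r ] × r ℚ.< s
      go ⊥₋<[ _ ]              = s ℚ.- ℚ.1ℚ , ⊥₋<[ _ ] , s-1<s
      go [ inj₁ i<j ]          = s ℚ.- ℚ.1ℚ , [ inj₁ i<j ] , s-1<s
      go [ inj₂ (refl , q<s) ] =
        let r , q<r , r<s = ℚ.<-dense q<s in r , [ inj₂ (refl , q<r) ] , r<s

    -- The blocks of Support S are recovered from its order: an interval is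
    -- well-ordered exactly when its end points are in the same block.

    module Blocks {S : Pred I s} (e : Enumeration κ (Support S)) where

      open Enumeration e
      open LO (order e) using (_≤_)

      block : κ → Block
      block x = proj₁ (at x)

      same-block⇒well-founded : ∀ {x y} → block x ≡ block y → WellFoundedInterval (order e) x y
      same-block⇒well-founded {x} {y} = go (<-wf _)
        where
        go : ∀ {y} → Acc _<_ (proj₂ (at y)) → block x ≡ block y → WellFoundedInterval (order e) x y
        go (acc rec) bx≡by = acc λ (x≤u , y≰u) →
          let u<y   = ≰⇒> y≰u
              bu≡by = block-sandwich x≤u (inj₁ u<y) bx≡by
          in go (rec (<-in-block bu≡by u<y)) (trans bx≡by (sym bu≡by))

      block-dense : ∀ {x y} → block x <₋ block y → ∃[ z ] block x <₋ block z × block z <₋ block y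
      block-dense {x} {y} l = go _ refl l (lands y)
        where
        go : ∀ v → at y ≡ v → block x <₋ proj₁ v → v ∈ Support S →
             ∃[ z ] block x <₋ block z × block z <₋ block y
        go ([ j , s ] , _) e l (j∈S , _) =
          let r , l′ , r<s = between-blocks l
              z , at-z = onto {y = [ j , r ] , code j} (j∈S , κ.irrefl refl)
          in z , subst (block x <₋_) (sym (cong proj₁ at-z)) l′
               , subst₂ _<₋_ (sym (cong proj₁ at-z)) (sym (cong proj₁ e)) [ inj₂ (refl , r<s) ]

      <-block⇒not-well-founded : ∀ {x y} → block x <₋ block y → ¬ WellFoundedInterval (order e) x y
      <-block⇒not-well-founded {x} {y} l (acc rec) =
        let z , l₁ , l₂ = block-dense {x} {y} l
        in <-block⇒not-well-founded l₁ (rec (inj₁ (inj₁ l₁) , <⇒≱ (inj₁ l₂)))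

      well-founded⇒same-block : ∀ {x y} → x ≤ y → WellFoundedInterval (order e) x y → block x ≡ block y
      well-founded⇒same-block {x} {y} x≤y w with Bl.compare (block x) (block y)
      ... | tri< l _ _ = contradiction w (<-block⇒not-well-founded l)
      ... | tri≈ _ e _ = e
      ... | tri> _ _ g = contradiction g (block-mono x≤y)

    -- An embedding that maps an interval, with end points in the blocks
    -- (i , q₀) and (i , q₁), onto an interval maps an intermediate block
    -- (i , q) onto a block (j , s), which has the same order type.

    module _ {S : Pred I s} {T : Pred I r}
             (e : Enumeration κ (Support S)) (e′ : Enumeration κ (Support T))
             {f : κ → κ} (f-emb : IsEmbedding (order e) (order e′) f) where

      private
        module S = Blocks e
        module T = Blocks e′
        module E = Enumeration e
        module E′ = Enumeration e′
        module L = LO (order e)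
        module M = LO (order e′)

      transfers-code : ∀ {i q₀ q₁ x₀ x₁ aₗ aᵣ} → i ∈ S → q₀ ℚ.< q₁ →
        E.at aₗ ≡ ([ i , q₀ ] , x₀) → E.at aᵣ ≡ ([ i , q₁ ] , x₁) →
        (∀ {w} → f aₗ M.≤ w → w M.≤ f aᵣ → ∃[ z ] f z ≡ w) →
        ∃[ j ] j ∈ T × code i ≡ code j
      transfers-code {i} {q₀} {q₁} {aₗ = aₗ} {aᵣ} i∈S q₀<q₁ at-aₗ at-aᵣ fills
        with q , q₀<q , q<q₁ ← ℚ.<-dense q₀<q₁
        with m , at-m ← E.onto {y = [ i , q ] , code i} (i∈S , κ.irrefl refl)
        = go _ refl (E′.lands (f m))
        where
        Inside : Pred κ _
        Inside x = aₗ L.≤ x × x L.≤ aᵣ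

        in-block⇒inside : ∀ {x} → S.block x ≡ [ i , q ] → Inside x
        in-block⇒inside bx =
          inj₁ (inj₁ (subst₂ _<₋_ (sym (cong proj₁ at-aₗ)) (sym bx) [ inj₂ (refl , q₀<q) ])) ,
          inj₁ (inj₁ (subst₂ _<₋_ (sym bx) (sym (cong proj₁ at-aᵣ)) [ inj₂ (refl , q<q₁) ]))

        preserve-≤ : ∀ {x y} → x L.≤ y → Inside x → Inside y →
                     S.block x ≡ S.block y → T.block (f x) ≡ T.block (f y)
        preserve-≤ {x} {y} x≤y (l , _) (_ , u) b =
          T.well-founded⇒same-block (Equivalence.to (f-emb x y) x≤y)
            (preserve-interval {L = order e} {M = order e′} f-emb
              (λ fx≤w w≤fy → fills (≤ᴾ.trans (Equivalence.to (f-emb aₗ x) l) fx≤w)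
                                   (≤ᴾ.trans w≤fy (Equivalence.to (f-emb y aᵣ) u)))
              (S.same-block⇒well-founded b))

        preserve : ∀ {x y} → Inside x → Inside y →
                   S.block x ≡ S.block y → T.block (f x) ≡ T.block (f y)
        preserve {x} {y} x∈ y∈ b with ≤ᴾ.total (E.at x) (E.at y)
        ... | inj₁ x≤y = preserve-≤ x≤y x∈ y∈ b
        ... | inj₂ y≤x = sym (preserve-≤ y≤x y∈ x∈ (sym b))

        reflect-≤ : ∀ {x y} → x L.≤ y → T.block (f x) ≡ T.block (f y) → S.block x ≡ S.block y
        reflect-≤ x≤y b = S.well-founded⇒same-block x≤y
          (reflect-interval {L = order e} {M = order e′} f-emb (T.same-block⇒well-founded b))

        reflect : ∀ {x y} → T.block (f x) ≡ T.block (f y) → S.block x ≡ S.block y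
        reflect {x} {y} b with ≤ᴾ.total (E.at x) (E.at y)
        ... | inj₁ x≤y = reflect-≤ x≤y b
        ... | inj₂ y≤x = sym (reflect-≤ y≤x (sym b))

        bm : S.block m ≡ [ i , q ]
        bm = cong proj₁ at-m

        m-inside : Inside m
        m-inside = in-block⇒inside bm

        left-differs : T.block (f aₗ) ≢ T.block (f m)
        left-differs b with refl ← trans (sym (cong proj₁ at-aₗ)) (trans (reflect b) bm) =
          ℚ.<-irrefl refl q₀<q

        right-differs : T.block (f aᵣ) ≢ T.block (f m)
        right-differs b with refl ← trans (sym (cong proj₁ at-aᵣ)) (trans (reflect b) bm) =
          ℚ.<-irrefl refl q<q₁

        go : ∀ v → E′.at (f m) ≡ v → v ∈ Support T → ∃[ j ] j ∈ T × code i ≡ code j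
        -- The image of m is not in the least block: that of aₗ lies in a lower one.
        go (⊥₋ , _) at-fm _ with Bl.compare (T.block (f aₗ)) (T.block (f m))
        ... | tri≈ _ b _ = contradiction b left-differs
        ... | tri< l _ _ with () ← subst (T.block (f aₗ) <₋_) (cong proj₁ at-fm) l
        ... | tri> _ _ g = contradiction g (block-mono (Equivalence.to (f-emb aₗ m) (proj₁ m-inside)))
        go ([ j , s ] , _) at-fm (j∈T , _) =
          j , j∈T , correspondence⇒≡ <-sto <-wf R total onto mono reflects
          where
          bfm : T.block (f m) ≡ [ j , s ]
          bfm = cong proj₁ at-fm

          R : Rel κ _
          R x y = ∃[ z ] E.at z ≡ ([ i , q ] , x) × E′.at (f z) ≡ ([ j , s ] , y)

          total : ∀ {x} → ¬ (code i < x) → ∃[ y ] ¬ (code j < y) × R x y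
          total {x} i≮x =
            let z , at-z = E.onto {y = [ i , q ] , x} (i∈S , i≮x)
                bz  = cong proj₁ at-z
                bfz = trans (preserve (in-block⇒inside bz) m-inside (trans bz (sym bm))) bfm
                at-fz = cong (_, proj₂ (E′.at (f z))) bfz
            in proj₂ (E′.at (f z)) , proj₂ (subst (Support T) at-fz (E′.lands (f z))) , z , at-z , at-fz

          onto : ∀ {y} → ¬ (code j < y) → ∃[ x ] ¬ (code i < x) × R x y
          onto {y} j≮y with w , at-w ← E′.onto {y = [ j , s ] , y} (j∈T , j≮y) = found (fills l u)
            where
            bw : T.block w ≡ T.block (f m)
            bw = trans (cong proj₁ at-w) (sym bfm)

            l : f aₗ M.≤ w
            l with ≤ᴾ.total (E′.at (f aₗ)) (E′.at w)
            ... | inj₁ l = l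
            ... | inj₂ g = contradiction
              (block-sandwich g (Equivalence.to (f-emb aₗ m) (proj₁ m-inside)) bw) left-differs

            u : w M.≤ f aᵣ
            u with ≤ᴾ.total (E′.at w) (E′.at (f aᵣ))
            ... | inj₁ l = l
            ... | inj₂ g = contradiction
              (trans (block-sandwich (Equivalence.to (f-emb m aᵣ) (proj₂ m-inside)) g (sym bw)) bw)
              right-differs

            found : ∃[ z ] f z ≡ w → ∃[ x ] ¬ (code i < x) × R x y
            found (z , refl) =
              let bz   = trans (reflect bw) bm
                  at-z = cong (_, proj₂ (E.at z)) bz
              in proj₂ (E.at z) , proj₂ (subst (Support S) at-z (E.lands z)) , z , at-z , at-w

          mono : ∀ {x y x′ y′} → R x y → R x′ y′ → x < x′ → y < y′
          mono (z , at-z , at-fz) (z′ , at-z′ , at-fz′) x<x′ =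
            <-in-block refl (subst₂ _<ᴾ_ at-fz at-fz′ (≰⇒> λ fz′≤fz →
              <⇒≱ (subst₂ _<ᴾ_ (sym at-z) (sym at-z′) (inj₂ (refl , x<x′)))
                  (Equivalence.from (f-emb z′ z) fz′≤fz)))

          reflects : ∀ {x y x′ y′} → R x y → R x′ y′ → y < y′ → x < x′
          reflects (z , at-z , at-fz) (z′ , at-z′ , at-fz′) y<y′ =
            <-in-block refl (subst₂ _<ᴾ_ at-z at-z′ (≰⇒> λ z′≤z →
              <⇒≱ (subst₂ _<ᴾ_ (sym at-fz) (sym at-fz′) (inj₂ (refl , y<y′)))
                  (Equivalence.to (f-emb z′ z) z′≤z)))

    -- Support S has the cardinality of κ if the coding is injective on S: it
    -- contains a copy of κ, and Point has only κ blocks over S.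

    enumerate : ℕ ↣ κ → {S : Pred I s} →
                (∀ {i j} → i ∈ S → j ∈ S → code i ≡ code j → i ≡ j) →
                Enumeration κ (Support S)
    enumerate ι {S} code-injective = SchröderBernstein.enumeration
      (record { to = ⊥₋ ,_ ; maps = λ _ → tt ; injective = λ _ _ → cong proj₂ })
      (record
        { to        = λ (β , x) → Injection.to pair (Injection.to (absorb ι) (block-code β) , x)
        ; maps      = λ _ → _
        ; injective = λ {u} {v} u∈ v∈ e →
            let e′ = Injection.injective pair e
            in point-injective u v u∈ v∈ (Injection.injective (absorb ι) (cong proj₁ e′)) (cong proj₂ e′)
        })
      where
      open Hessenberg <-sto <-wf using (absorb; κ×κ↣κ)

      pair : (κ × κ) ↣ κ
      pair = κ×κ↣κ ι

      pair-ℚ : (κ × ℚ) ↣ κ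
      pair-ℚ = pair ↣-∘ ×-↣ (mk↣ id) (ι ↣-∘ ℚ↣ℕ)

      block-code : Block → ℕ ⊎ κ
      block-code ⊥₋        = inj₁ 0
      block-code [ i , q ] = inj₂ (Injection.to pair-ℚ (code i , q))

      point-injective : ∀ u v → u ∈ Support S → v ∈ Support S →
        block-code (proj₁ u) ≡ block-code (proj₁ v) → proj₂ u ≡ proj₂ v → u ≡ v
      point-injective (⊥₋ , x) (⊥₋ , y) _ _ _ e = cong (⊥₋ ,_) e
      point-injective ([ i , q ] , x) ([ j , r ] , y) (i∈S , _) (j∈S , _) e e′ =
        cong₂ _,_ (cong [_] (cong₂ _,_ (code-injective i∈S j∈S (cong proj₁ codes)) (cong proj₂ codes))) e′
        where
        codes : (code i , q) ≡ (code j , r)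
        codes = Injection.injective pair-ℚ (inj₂-injective e)

    module Comparison (𝓛 : Pred (Lin κ) p) {S : Pred I s} {T : Pred I r}
                      (e : Enumeration κ (Support S)) (e′ : Enumeration κ (Support T)) where

      private
        module E = Enumeration e
        module E′ = Enumeration e′
        module M = LO (order e′)

      -- For i ∈ S choose one point in each block (i , q).  Since K is scattered,
      -- the points for some q < q′ lie in the same part of the K-convex
      -- partition, and the interval between them is mapped onto an interval.

      ⊴⇒⊆ : (∀ K → K ∈ 𝓛 → Scattered (Lin.order K)) →
             (∀ {i j} → i ∈ S → j ∈ T → code i ≡ code j → i ≡ j) →
             order e ⊴[ 𝓛 ] order e′ → S ⊆ T
      ⊴⇒⊆ scattered code-injective (K , K∈𝓛 , P , f , f-emb , f-convex) {i} i∈S =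
        conclude (by-contradiction λ none →
          scattered K K∈𝓛 (index , λ q q′ → mk⇔ (index-mono none) (index-reflects none)))
        where
        open ConvexPartition P
        module K = LO (Lin.order K)
        module K≤ = IsTotalOrder K.isTotalOrder

        point : ℚ → κ
        point q = proj₁ (E.onto {y = [ i , q ] , code i} (i∈S , κ.irrefl refl))

        at-point : ∀ q → E.at (point q) ≡ ([ i , q ] , code i)
        at-point q = proj₂ (E.onto (i∈S , κ.irrefl refl))

        point-mono : ∀ {q q′} → q ℚ.< q′ → E.at (point q) <ᴾ E.at (point q′)
        point-mono {q} {q′} l =
          subst₂ _<ᴾ_ (sym (at-point q)) (sym (at-point q′)) (inj₁ [ inj₂ (refl , l) ])

        index : ℚ → Lin.Carrier K
        index q = proj₁ (covers (point q))

        in-part : ∀ q → part (index q) (point q)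
        in-part q = proj₂ (covers (point q))

        Some None : Set _
        Some = ∃[ q ] ∃[ q′ ] q ℚ.< q′ × index q ≡ index q′
        None = ¬ Some

        index-< : None → ∀ {q q′} → q ℚ.< q′ → index q K.≤ index q′
        index-< none {q} {q′} l with K≤.total (index q) (index q′)
        ... | inj₁ k≤k′ = k≤k′
        ... | inj₂ k′≤k = contradiction
          (proj₁ (Equivalence.to (ordered (index q′) (index q))
            (k′≤k , λ e → none (q , q′ , l , sym e)) (in-part q′) (in-part q)))
          (<⇒≱ (point-mono l))

        index-mono : None → ∀ {q q′} → q ℚ.≤ q′ → index q K.≤ index q′
        index-mono none {q} {q′} q≤q′ with ℚ.<-cmp q q′
        ... | tri< l _ _    = index-< none l
        ... | tri≈ _ refl _ = K≤.refl
        ... | tri> _ _ g    = contradiction (ℚ.<-≤-trans g q≤q′) (ℚ.<-irrefl refl)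

        index-reflects : None → ∀ {q q′} → index q K.≤ index q′ → q ℚ.≤ q′
        index-reflects none {q} {q′} k≤k′ with ℚ.<-cmp q q′
        ... | tri< l _ _    = ℚ.<⇒≤ l
        ... | tri≈ _ refl _ = ℚ.≤-refl
        ... | tri> _ _ g    = contradiction (q′ , q , g , K≤.antisym (index-< none g) k≤k′) none

        conclude : Some → i ∈ T
        conclude (q , q′ , q<q′ , same) =
          let j , j∈T , code≡ = transfers-code e e′ f-emb i∈S q<q′ (at-point q) (at-point q′) λ l u →
                let z , _ , fz≡ = f-convex (index q) l u
                      (point q , in-part q , refl)
                      (point q′ , subst (λ k → part k (point q′)) (sym same) (in-part q′) , refl)
                in z , fz≡
          in subst T (sym (code-injective i∈S j∈T code≡)) j∈T

      -- If S is an initial segment of T, then Support S is one of Support T, and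
      -- a partition into a single part suffices.

      initial⇒⊴ : Satisfiable 𝓛 → DownwardClosed 𝓛 →
                  S ⊆ T → (∀ {i j} → i ∈ T → j ∈ S → i <ᴵ j → i ∈ S) →
                  order e ⊴[ 𝓛 ] order e′
      initial⇒⊴ (L , L∈𝓛) closed S⊆T initial =
        one , closed {one} {L} one≼L L∈𝓛 , trivial , f , f-emb , λ _ → f-convex
        where
        one : Lin κ
        one = record
          { Carrier    = ⊤
          ; order      = record
            { _≤_          = λ _ _ → ⊤
            ; isTotalOrder = record
              { isPartialOrder = record
                { isPreorder = record { isEquivalence = isEquivalence ; reflexive = _ ; trans = _ }
                ; antisym    = λ _ _ → refl
                }
              ; total = λ _ _ → inj₁ tt
              }
            }
          ; inhabitant = tt
          ; size       = mk↣ {to = λ _ → Injection.to (Lin.size L) (Lin.inhabitant L)} λ _ → refl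
          }

        one≼L : Lin.order one ≼ Lin.order L
        one≼L = (λ _ → Lin.inhabitant L) ,
          λ _ _ → mk⇔ (λ _ → IsTotalOrder.refl (Lin.isTotalOrder L)) _

        trivial : ConvexPartition (Lin.order one) (order e)
        trivial = record
          { part     = λ _ _ → ⊤
          ; nonempty = λ _ → proj₁ (E.onto {y = ⊥₋ , Injection.to (Lin.size L) (Lin.inhabitant L)} tt) , tt
          ; covers   = λ _ → tt , tt
          ; disjoint = λ _ _ → refl
          ; ordered  = λ _ _ → mk⇔ (λ (_ , ne) → contradiction refl ne)
              (λ l → contradiction refl
                (proj₂ (l {proj₁ (E.onto {y = ⊥₋ , Injection.to (Lin.size L) (Lin.inhabitant L)} tt)} tt tt)))
          }

        support-mono : ∀ {u} → u ∈ Support S → u ∈ Support T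
        support-mono {⊥₋ , _}    _         = tt
        support-mono {[ _ ] , _} (i∈S , l) = S⊆T i∈S , l

        support-initial : ∀ {u v} → u ≤ᴾ v → u ∈ Support T → v ∈ Support S → u ∈ Support S
        support-initial (inj₂ refl) _ v∈ = v∈
        support-initial {⊥₋ , _} _ _ _ = tt
        support-initial {[ _ ] , _} {[ _ ] , _} (inj₁ (inj₁ [ inj₁ i<j ])) (i∈T , l) (j∈S , _) =
          initial i∈T j∈S i<j , l
        support-initial {[ _ ] , _} {[ _ ] , _} (inj₁ (inj₁ [ inj₂ (refl , _) ])) (_ , l) (j∈S , _) =
          j∈S , l
        support-initial {[ _ ] , _} {[ _ ] , _} (inj₁ (inj₂ (refl , _))) (_ , l) (j∈S , _) = j∈S , l

        image-of : ∀ x → ∃[ y ] E′.at y ≡ E.at x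
        image-of x = E′.onto (support-mono (E.lands x))

        f : κ → κ
        f x = proj₁ (image-of x)

        f-emb : IsEmbedding (order e) (order e′) f
        f-emb x y = mk⇔ (subst₂ _≤ᴾ_ (sym (proj₂ (image-of x))) (sym (proj₂ (image-of y))))
                        (subst₂ _≤ᴾ_ (proj₂ (image-of x)) (proj₂ (image-of y)))

        f-convex : Convex (order e′) (image f (λ _ → ⊤ {a}))
        f-convex {y = y} _ y≤fz _ (z , _ , refl) =
          let x , at-x = E.onto {y = E′.at y} (support-initial (subst (E′.at y ≤ᴾ_) (proj₂ (image-of z)) y≤fz)
                                                   (E′.lands y) (E.lands z))
          in x , tt , E′.injective (trans (proj₂ (image-of x)) at-x)

  -- Chains and antichains of sums

  module Families {ℓ} (𝜿 : InfiniteCardinal ℓ)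
                  (𝓛 : Pred (Lin (InfiniteCardinal.Carrier 𝜿)) p)
                  (scattered : ∀ L → L ∈ 𝓛 → Scattered (Lin.order L))
                  (nonempty : Satisfiable 𝓛) (closed : DownwardClosed 𝓛) where

    open InfiniteCardinal 𝜿 using (_<_) renaming
      (Carrier to κ; isStrictTotalOrder to <-sto; wellFounded to <-wf; infinite to ω)

    private
      module κ = IsStrictTotalOrder <-sto

    open Hessenberg <-sto <-wf using (κ×κ↣κ)

    abstract
      pair : (κ × κ) ↣ κ
      pair = κ×κ↣κ ω

      tag : (κ × Bool) ↣ κ
      tag = pair ↣-∘ ×-↣ (mk↣ id) (ω ↣-∘ Bool↣ℕ)

    -- The orders Support (S x) with domain κ, for a family of subsets S x of I
    -- on whose union the coding is injective.

    module Family {I : Set ℓ} {_<ᴵ_ : Rel I ℓ} (<ᴵ-sto : IsStrictTotalOrder _≡_ _<ᴵ_)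
                  (code : I → κ) {M : Set a} (S : M → Pred I s)
                  (code-injective : ∀ {x y i j} → i ∈ S x → j ∈ S y → code i ≡ code j → i ≡ j)
                  where

      open Sum <-sto <-wf <ᴵ-sto code

      abstract
        enumeration : ∀ x → Enumeration κ (Support (S x))
        enumeration x = enumerate ω code-injective

      sum : M → LO κ
      sum x = order (enumeration x)

      sum-⊴⇒⊆ : ∀ {x y} → ⊴κ 𝓛 (sum x) (sum y) → S x ⊆ S y
      sum-⊴⇒⊆ {x} {y} =
        Comparison.⊴⇒⊆ 𝓛 (enumeration x) (enumeration y) scattered code-injective

      initial⇒sum-⊴ : ∀ {x y} → S x ⊆ S y →
                      (∀ {i j} → i ∈ S y → j ∈ S x → i <ᴵ j → i ∈ S x) →
                      ⊴κ 𝓛 (sum x) (sum y)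
      initial⇒sum-⊴ {x} {y} = Comparison.initial⇒⊴ 𝓛 (enumeration x) (enumeration y) nonempty closed

      chain : {_≤_ : Rel M r} →
              (∀ {x y} → x ≤ y → S x ⊆ S y) → (∀ {x y} → S x ⊆ S y → x ≤ y) →
              (∀ {x y i j} → i ∈ S y → j ∈ S x → i <ᴵ j → i ∈ S x) →
              HasChain 𝓛 _≤_
      chain mono reflects initial = sum , λ x y → mk⇔
        (λ x⊴y → reflects (sum-⊴⇒⊆ x⊴y))
        (λ x≤y → initial⇒sum-⊴ (mono x≤y) initial)

    strict-order : {I : Set a} {_≤_ : Rel I b} → IsTotalOrder _≡_ _≤_ →
                   IsStrictTotalOrder _≡_ (ToStrict._<_ _≡_ _≤_)
    strict-order = ToStrict.<-isStrictTotalOrder₁ _≡_ _ (λ _ _ → em)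

    -- The sets of all z ≤ x, for x in M, form a chain of initial segments.

    linear-chain : (M : Lin κ) → HasChain 𝓛 (Lin._≤_ M)
    linear-chain M = Family.chain (strict-order isTotalOrder) (Injection.to size)
      (λ x z → z ≤ x) (λ _ _ → Injection.injective size)
      (λ x≤y z≤x → ≤-trans z≤x x≤y) (λ lower → lower ≤-refl)
      (λ _ j≤x i<j → ≤-trans (proj₁ i<j) j≤x)
      where
      open Lin M
      open IsTotalOrder isTotalOrder renaming (trans to ≤-trans; refl to ≤-refl)

    reverse : Lin κ → Lin κ
    reverse M = record
      { Carrier    = Carrier
      ; order      = record { isTotalOrder = Flip.isTotalOrder isTotalOrder }
      ; inhabitant = inhabitant
      ; size       = size
      }
      where open Lin M

    -- Graphs of distinct functions are incomparable under inclusion.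

    antichain : HasAntichainOfSize 𝓛 (κ → Bool)
    antichain =
      mk↣ {to = sum} (λ {F} {G} e → graph-injective
        (sum-⊴⇒⊆ (subst (⊴κ 𝓛 (sum F)) e (initial⇒sum-⊴ {F} id λ i∈ _ _ → i∈)))) ,
      λ F G F≢G → (λ l → F≢G (graph-injective (sum-⊴⇒⊆ l))) ,
                  (λ l → F≢G (sym (graph-injective (sum-⊴⇒⊆ l))))
      where
      graph : (κ → Bool) → Pred (κ × Bool) _
      graph F (α , b) = F α ≡ b

      graph-injective : ∀ {F G} → graph F ⊆ graph G → F ≡ G
      graph-injective F⊆G = ext λ α → sym (F⊆G refl)

      open Family (×-isStrictTotalOrder-≡ <-sto Bool.<-isStrictTotalOrder) (Injection.to tag)
                  graph (λ _ _ → Injection.injective tag)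

    -- The lexicographic order on κ → κ

    least : {P : Pred κ r} → ∃ P → ∃[ α ] α ∈ P × (∀ β → β < α → β ∉ P)
    least {P = P} (α , α∈P) = go (<-wf α) α∈P
      where
      go : ∀ {α} → Acc _<_ α → α ∈ P → ∃[ α ] α ∈ P × (∀ β → β < α → β ∉ P)
      go {α} (acc rec) α∈P with em {P = ∃[ β ] β < α × β ∈ P}
      ... | yes (β , β<α , β∈P) = go (rec β<α) β∈P
      ... | no none             = α , α∈P , λ β β<α β∈P → none (β , β<α , β∈P)

    _<ˡ_ _≤ˡ_ : Rel (κ → κ) ℓ
    _<ˡ_ = _<lex_ 𝜿
    _≤ˡ_ = _≤lex_ 𝜿

    <ˡ-trans : Transitive _<ˡ_
    <ˡ-trans {f} {g} {h} (α , fα<gα , f≡g) (β , gβ<hβ , g≡h) with κ.compare α β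
    ... | tri< α<β _ _ = α , subst (f α <_) (g≡h α α<β) fα<gα ,
      λ γ γ<α → trans (f≡g γ γ<α) (g≡h γ (κ.trans γ<α α<β))
    ... | tri≈ _ refl _ = α , κ.trans fα<gα gβ<hβ , λ γ γ<α → trans (f≡g γ γ<α) (g≡h γ γ<α)
    ... | tri> _ _ β<α = β , subst (_< h β) (sym (f≡g β β<α)) gβ<hβ ,
      λ γ γ<β → trans (f≡g γ (κ.trans γ<β β<α)) (g≡h γ γ<β)

    <ˡ-irrefl : ∀ {f} → ¬ (f <ˡ f)
    <ˡ-irrefl (_ , l , _) = κ.irrefl refl l

    <ˡ-connected : ∀ {f g} → f ≢ g → f <ˡ g ⊎ g <ˡ f
    <ˡ-connected {f} {g} f≢g
      with α , fα≢gα , below ← least {P = λ α → f α ≢ g α}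
             (by-contradiction λ none → f≢g (ext λ α → by-contradiction λ ne → none (α , ne)))
      with κ.compare (f α) (g α)
    ... | tri< l _ _ = inj₁ (α , l , λ β β<α → by-contradiction (below β β<α))
    ... | tri≈ _ e _ = contradiction e fα≢gα
    ... | tri> _ _ g = inj₂ (α , g , λ β β<α → sym (by-contradiction (below β β<α)))

    ≤ˡ-isTotalOrder : IsTotalOrder _≡_ _≤ˡ_
    ≤ˡ-isTotalOrder = record
      { isPartialOrder = record
        { isPreorder = record
          { isEquivalence = isEquivalence
          ; reflexive     = inj₁
          ; trans         = λ { (inj₁ refl) l → l
                              ; l@(inj₂ _) (inj₁ refl) → l
                              ; (inj₂ l) (inj₂ l′) → inj₂ (<ˡ-trans l l′) }
          }
        ; antisym = λ { (inj₁ e) _ → e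
                      ; (inj₂ _) (inj₁ e) → sym e
                      ; (inj₂ l) (inj₂ l′) → contradiction (<ˡ-trans l l′) <ˡ-irrefl }
        }
      ; total = total
      }
      where
      total : ∀ f g → f ≤ˡ g ⊎ g ≤ˡ f
      total f g with em {P = f ≡ g}
      ... | yes e = inj₁ (inj₁ e)
      ... | no ne = [ inj₁ ∘ inj₂ , inj₂ ∘ inj₂ ]′ (<ˡ-connected ne)

    <ˡ⇒≱ˡ : ∀ {f g} → f <ˡ g → ¬ (g ≤ˡ f)
    <ˡ⇒≱ˡ l (inj₁ refl) = <ˡ-irrefl l
    <ˡ⇒≱ˡ l (inj₂ g)    = <ˡ-irrefl (<ˡ-trans l g)

    ≮ˡ⇒≥ˡ : ∀ {f g} → ¬ (f <ˡ g) → g ≤ˡ f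
    ≮ˡ⇒≥ˡ {f} {g} n with IsTotalOrder.total ≤ˡ-isTotalOrder g f
    ... | inj₁ l        = l
    ... | inj₂ (inj₁ e) = inj₁ (sym e)
    ... | inj₂ (inj₂ l) = contradiction l n

    -- Functions of bounded support

    minimum : ∃[ z ] (∀ β → ¬ (β < z))
    minimum = let z , _ , min = least {P = U} (Injection.to ω 0 , _) in z , λ β β<z → min β β<z _

    -- The least element of κ.
    𝟘 : κ
    𝟘 = proj₁ minimum

    -- The functions with value 𝟘 above some α.

    Bounded : Pred (κ → κ) ℓ
    Bounded f = ∃[ α ] (∀ β → α < β → f β ≡ 𝟘)

    -- The function d agrees with g up to the first place where f and g differ,
    -- and vanishes above it.

    bounded-dense : ∀ {f g} → f <ˡ g → ∃[ d ] d ∈ Bounded × f <ˡ d × d ≤ˡ g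
    bounded-dense {f} {g} (α , fα<gα , f≡g) =
      d , (α , λ β α<β → above em α<β) ,
      (α , subst (f α <_) (sym (upto em (κ.irrefl refl))) fα<gα ,
           λ β β<α → trans (f≡g β β<α) (sym (upto em (κ.asym β<α)))) ,
      ≮ˡ⇒≥ˡ λ (β , gβ<dβ , _) → not-less em gβ<dβ
      where
      cut : ∀ β → Dec (α < β) → κ
      cut β (yes _) = 𝟘
      cut β (no _)  = g β

      d : κ → κ
      d β = cut β em

      above : ∀ {β} (i : Dec (α < β)) → α < β → cut β i ≡ 𝟘
      above (yes _)  _   = refl
      above (no α≮β) α<β = contradiction α<β α≮β

      upto : ∀ {β} (i : Dec (α < β)) → ¬ (α < β) → cut β i ≡ g β
      upto (yes α<β) α≮β = contradiction α<β α≮β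
      upto (no _)    _   = refl

      not-less : ∀ {β} (i : Dec (α < β)) → ¬ (g β < cut β i)
      not-less (yes _) = proj₂ minimum _
      not-less (no _)  = κ.irrefl refl

    -- Chains of type ℝκ

    module _ (κ^<κ : κ^<κ≡κ 𝜿) where

      -- A function of bounded support is determined by a bound α, its restriction to
      -- the ordinals below α and its value at α.

      bounded-code : ∀ f → Dec (f ∈ Bounded) → κ
      bounded-code f (yes (α , _)) =
        Injection.to pair (Bijection.to κ^<κ (α , λ β → f (value β)) , f α)
      bounded-code f (no _)        = 𝟘

      bounded-code-injective : ∀ {f g} (d : Dec (f ∈ Bounded)) (d′ : Dec (g ∈ Bounded)) →
        f ∈ Bounded → g ∈ Bounded → bounded-code f d ≡ bounded-code g d′ → f ≡ g
      bounded-code-injective (no n) _ f∈ _ _ = contradiction f∈ n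
      bounded-code-injective (yes _) (no n) _ g∈ _ = contradiction g∈ n
      bounded-code-injective {f} {g} (yes (α , f-above)) (yes (α′ , g-above)) _ _ e =
        agree α′ g-above (Bijection.injective κ^<κ (cong proj₁ e′)) (cong proj₂ e′)
        where
        e′ : (Bijection.to κ^<κ (α , λ β → f (value β)) , f α) ≡
             (Bijection.to κ^<κ (α′ , λ β → g (value β)) , g α′)
        e′ = Injection.injective pair e

        Restriction : Set ℓ
        Restriction = Σ[ α ∈ κ ] ([ β ∈ κ ∣ β < α ] → κ)

        agree : ∀ α′ → (∀ β → α′ < β → g β ≡ 𝟘) →
                (Restriction ∋ (α , λ β → f (value β))) ≡ (α′ , λ β → g (value β)) →
                f α ≡ g α′ → f ≡ g
        agree α′ g-above r v with refl ← cong proj₁ r = ext λ β → at β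
          where
          restrictions-agree : ∀ {h h′ : [ β ∈ κ ∣ β < α ] → κ} → (Restriction ∋ (α , h)) ≡ (α , h′) → h ≡ h′
          restrictions-agree refl = refl

          at : ∀ β → f β ≡ g β
          at β with κ.compare β α
          ... | tri< l _ _    = cong-app (restrictions-agree r) (β , [ l ])
          ... | tri≈ _ refl _ = v
          ... | tri> _ _ l    = trans (f-above β l) (sym (g-above β l))

      _≤ᴿ_ : Rel (ℝκ 𝜿) ℓ
      _≤ᴿ_ = ℝκ-≤ 𝜿

      ≤ᴿ-isTotalOrder : IsTotalOrder _≡_ _≤ᴿ_
      ≤ᴿ-isTotalOrder = record
        { isPartialOrder = record
          { isPreorder = record
            { isEquivalence = isEquivalence
            ; reflexive     = λ { refl → S.refl }
            ; trans         = S.trans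
            }
          ; antisym = λ x≤y y≤x → pointwise (S.antisym x≤y y≤x)
          }
        ; total = S.total
        }
        where
        module S = IsTotalOrder (⊎-<-isTotalOrder (Flip.isTotalOrder ≤ˡ-isTotalOrder)
                                                  (On.isTotalOrder value ≤ˡ-isTotalOrder))
        pointwise : ∀ {x y : ℝκ 𝜿} → PW.Pointwise _≡_ (_≡_ on value) x y → x ≡ y
        pointwise (PW.inj₁ e) = cong inj₁ e
        pointwise (PW.inj₂ e) = cong inj₂ (value-injective e)

      open ToStrict _≡_ _≤ᴿ_ using () renaming (_<_ to _<ᴿ_)
      private module ≤ᴿ = IsTotalOrder ≤ᴿ-isTotalOrder

      Boundedᴿ : Pred (ℝκ 𝜿) ℓ
      Boundedᴿ (inj₁ f) = f ∈ Bounded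
      Boundedᴿ (inj₂ f) = value f ∈ Bounded

      codeᴿ : ℝκ 𝜿 → κ
      codeᴿ (inj₁ f) = Injection.to tag (bounded-code f em , false)
      codeᴿ (inj₂ f) = Injection.to tag (bounded-code (value f) em , true)

      codeᴿ-injective : ∀ {x y} → x ∈ Boundedᴿ → y ∈ Boundedᴿ → codeᴿ x ≡ codeᴿ y → x ≡ y
      codeᴿ-injective {inj₁ f} {inj₁ g} f∈ g∈ e =
        cong inj₁ (bounded-code-injective em em f∈ g∈ (cong proj₁ (Injection.injective tag e)))
      codeᴿ-injective {inj₁ f} {inj₂ g} _ _ e with () ← cong proj₂ (Injection.injective tag e)
      codeᴿ-injective {inj₂ f} {inj₁ g} _ _ e with () ← cong proj₂ (Injection.injective tag e)
      codeᴿ-injective {inj₂ f} {inj₂ g} f∈ g∈ e =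
        cong inj₂ (value-injective (bounded-code-injective em em f∈ g∈ (cong proj₁ (Injection.injective tag e))))

      -- The elements of bounded support below x.  Between f < g lexicographically,
      -- bounded-dense provides d with f < d ≤ g, where d = g is possible.  So x
      -- has to belong to its cut in the lexicographic half of ℝκ, and not to
      -- belong to it in the reversed half.

      Cut : ℝκ 𝜿 → Pred (ℝκ 𝜿) ℓ
      Cut x@(inj₁ _) d = d ∈ Boundedᴿ × d <ᴿ x
      Cut x@(inj₂ _) d = d ∈ Boundedᴿ × d ≤ᴿ x

      Cut⊆Boundedᴿ : ∀ {x} → Cut x ⊆ Boundedᴿ
      Cut⊆Boundedᴿ {inj₁ _} = proj₁
      Cut⊆Boundedᴿ {inj₂ _} = proj₁

      <ᴿ-≤ᴿ-trans : ∀ {x y z} → x <ᴿ y → y ≤ᴿ z → x <ᴿ z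
      <ᴿ-≤ᴿ-trans = ToStrict.<-≤-trans _≡_ _≤ᴿ_ sym ≤ᴿ.trans ≤ᴿ.antisym ≤ᴿ.≤-respʳ-≈

      Cut-mono : ∀ {x y} → x ≤ᴿ y → Cut x ⊆ Cut y
      Cut-mono {inj₁ _} {inj₁ _} x≤y (d∈ , d<x) = d∈ , <ᴿ-≤ᴿ-trans d<x x≤y
      Cut-mono {inj₁ _} {inj₂ _} x≤y (d∈ , d<x) = d∈ , ≤ᴿ.trans (proj₁ d<x) x≤y
      Cut-mono {inj₂ _} {inj₂ _} x≤y (d∈ , d≤x) = d∈ , ≤ᴿ.trans d≤x x≤y

      Cut-lower : ∀ {x d d′} → d ∈ Boundedᴿ → d′ ∈ Cut x → d <ᴿ d′ → d ∈ Cut x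
      Cut-lower {inj₁ _} d∈ (_ , d′<x) d<d′ = d∈ , <ᴿ-≤ᴿ-trans d<d′ (proj₁ d′<x)
      Cut-lower {inj₂ _} d∈ (_ , d′≤x) d<d′ = d∈ , ≤ᴿ.trans (proj₁ d<d′) d′≤x

      ¬min : ∀ {f g} → f <ˡ g → ¬ IsMin 𝜿 g
      ¬min {f} l min = <ˡ⇒≱ˡ l (min f)

      below : (g : [ f ∈ (κ → κ) ∣ ¬ IsMin 𝜿 f ]) → ∃[ f ] f <ˡ value g
      below (g , [ nmin ]) with em {P = ∃[ f ] f <ˡ g}
      ... | yes b   = b
      ... | no none = ⊥-elim-irr (nmin λ f → ≮ˡ⇒≥ˡ λ l → none (f , l))

      Cut-separates : ∀ {x y} → x ≢ y → x ≤ᴿ y → ∃[ d ] d ∈ Cut y × d ∉ Cut x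
      Cut-separates x≢y (₁∼₁ (inj₁ refl)) = contradiction refl x≢y
      Cut-separates x≢y (₁∼₁ (inj₂ g<f)) =
        let d , d∈ , g<d , d≤f = bounded-dense g<f
        in inj₁ d , (d∈ , ₁∼₁ (inj₂ g<d) , λ e → <ˡ⇒≱ˡ g<d (inj₁ (inj₁-injective e))) ,
           λ (_ , d<f , d≢f) → d≢f (≤ᴿ.antisym d<f (₁∼₁ d≤f))
      Cut-separates x≢y (₁∼₂ {y = g}) =
        let d , d∈ , f<d , d≤g = bounded-dense (proj₂ (below g))
        in inj₂ (d , [ ¬min f<d ]) , (d∈ , ₂∼₂ d≤g) , λ { (_ , () , _) }
      Cut-separates x≢y (₂∼₂ (inj₁ e)) = contradiction (cong inj₂ (value-injective e)) x≢y
      Cut-separates x≢y (₂∼₂ (inj₂ f<g)) =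
        let d , d∈ , f<d , d≤g = bounded-dense f<g
        in inj₂ (d , [ ¬min f<d ]) , (d∈ , ₂∼₂ d≤g) , λ { (_ , ₂∼₂ d≤f) → <ˡ⇒≱ˡ f<d d≤f }

      Cut-reflects : ∀ {x y} → Cut x ⊆ Cut y → x ≤ᴿ y
      Cut-reflects {x} {y} x⊆y with ≤ᴿ.total x y | em {P = y ≡ x}
      ... | inj₁ x≤y | _        = x≤y
      ... | inj₂ _   | yes refl = ≤ᴿ.refl
      ... | inj₂ y≤x | no y≢x   =
        let d , d∈x , d∉y = Cut-separates y≢x y≤x in contradiction (x⊆y d∈x) d∉y

      ℝκ-chain : HasChain 𝓛 _≤ᴿ_
      ℝκ-chain = Family.chain (strict-order ≤ᴿ-isTotalOrder) codeᴿ Cut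
        (λ {x} {y} i∈ j∈ → codeᴿ-injective (Cut⊆Boundedᴿ {x} i∈) (Cut⊆Boundedᴿ {y} j∈))
        Cut-mono Cut-reflects
        (λ {x} {y} i∈y → Cut-lower {x} (Cut⊆Boundedᴿ {y} i∈y))

theorem8p6 : (∀ {a} → ExcludedMiddle a) →
    (∀ {a b} → Extensionality a b) →
    ∀ {ℓ p} (𝜿 : InfiniteCardinal ℓ) →
    let κ = InfiniteCardinal.Carrier 𝜿 in
    (𝓛 : Pred (Lin κ) p) →
    (∀ L → L ∈ 𝓛 → Scattered (Lin.order L)) →
    Satisfiable 𝓛 →
    DownwardClosed 𝓛 →
    Transitive (⊴κ 𝓛) →
    (∀ (M : Lin κ) → HasChain 𝓛 (Lin._≤_ M)) ×
    (∀ (α : Lin κ) → IsWellOrder α →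
    HasChain 𝓛 (Lin._≤_ α) × HasChain 𝓛 (flip (Lin._≤_ α))) ×
    (κ^<κ≡κ 𝜿 → HasChain 𝓛 (ℝκ-≤ 𝜿)) ×
    HasAntichainOfSize 𝓛 (κ → Bool)
theorem8p6 em ext 𝜿 𝓛 scattered nonempty closed _ =
  linear-chain ,
  (λ α _ → linear-chain α , linear-chain (reverse α)) ,
  ℝκ-chain ,
  antichain
  where open Classical.Families em ext 𝜿 𝓛 scattered nonempty closed
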